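{- Let $G$ be a finite simple graph, let $G_E$ be its reduced graph with respect to the relation $\sim$, and let $G_{E'}$ be the analogous quotient graph with respect to the relation $\sim'$. Then $\mathrm{box}(G_E)=\mathrm{box}(G_{E'})$.
   Context: Let $G=(V,E)$ be a finite simple graph and let $N(v)$ denote the set of neighbours of $v$. For $u,v\in V$ write $u\sim v$ if $N(u)=N(v)$, and $u\sim' v$ if $N(u)\setminus\{u,v\}=N(v)\setminus\{u,v\}$. Both are equivalence relations on $V$; denote the class of $v$ by $[v]$ and $[v]'$, respectively. The reduced graph $G_E$ has vertex set $\{[v]\colon v\in V\}$ and edge set $\{\{[u],[v]\}\colon \{u,v\}\in E\}$. The graph $G_{E'}$ has vertex set $\{[v]'\colon v\in V\}$ and edge set $\{\{[u]',[v]'\}\colon [u]'\ne[v]' \text{ and } \{u,v\}\in E\}$. The boxicity $\mathrm{box}(H)$ of a finite simple graph $H$ is the minimum integer $d\ge 0$ such that there exist $d$ interval graphs $I_1,\dots,I_d$ on $V(H)$ with $E(H)=\bigcap_{j=1}^d E(I_j)$; the empty intersection ($d=0$) is the set of all pairs of vertices, so $\mathrm{box}(H)=0$ iff $H$ is complete. -}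

module Defs where

open import Data.Fin.Base using (Fin)
open import Data.List.Base using (List)
import Data.List.Membership.Setoid as Membership
import Data.List.Relation.Unary.All as All
import Data.List.Relation.Unary.Any as Any
open import Data.List.Relation.Unary.Enumerates.Setoid using (IsEnumeration)
open import Data.Nat.Base as ℕ using (ℕ)
open import Data.Product.Base using (∃; ∃-syntax; ∃₂; Σ-syntax; _×_; _,_; proj₁)
open import Data.Rational.Base as ℚ using (ℚ)
open import Data.Sum.Base using (_⊎_; inj₁; inj₂; swap)
open import Function.Base using (_∘_)
open import Function.Bundles using (_⇔_)
open import Level using (0ℓ)
open import Relation.Binary.Bundles using (DecSetoid)
open import Relation.Binary.Core using (Rel; _⇒_)
open import Relation.Binary.Definitions
  using (Decidable; Irreflexive; Symmetric; _Respectsʳ_; _Respects_)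
open import Relation.Binary.Structures using (IsDecEquivalence)
open import Relation.Nullary.Decidable
  using (Dec; yes; no; map′; ¬?; _×-dec_; _⊎-dec_; _→-dec_)
open import Relation.Nullary.Negation using (¬_)
import Relation.Unary as U
open import Relation.Unary using (Pred; _≐_; _∖_)
open import Relation.Unary.Properties using (≐-refl; ≐-sym; ≐-trans)

-- The equality is an arbitrary decidable equivalence, so that quotients
-- of finite sets are again finite sets.

record FiniteSet : Set₁ where
  field
    decSetoid : DecSetoid 0ℓ 0ℓ

  open DecSetoid decSetoid public

  field
    elements   : List Carrier
    enumerates : IsEnumeration setoid elements

  open Membership setoid using (find; lose)

  ∃? : {P : Pred Carrier 0ℓ} → P Respects _≈_ → U.Decidable P → Dec (∃ P)
  ∃? resp P? = map′
    (λ p → let x , _ , px = find p in x , px)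
    (λ (x , px) → lose resp (enumerates x) px)
    (Any.any? P? elements)

  ∀? : {P : Pred Carrier 0ℓ} → P Respects _≈_ → U.Decidable P →
       Dec (∀ {x} → P x)
  ∀? resp P? = map′
    (λ ps {x} → All.lookupₛ setoid resp ps (enumerates x))
    (λ p → All.tabulateₛ setoid (λ _ → p))
    (All.all? P? elements)

  ≐? : {P Q : Pred Carrier 0ℓ} → P Respects _≈_ → Q Respects _≈_ →
       U.Decidable P → U.Decidable Q → Dec (P ≐ Q)
  ≐? P-resp Q-resp P? Q? =
    ∀? (λ x≈y p⇒q → Q-resp x≈y ∘ p⇒q ∘ P-resp (sym x≈y))
       (λ x → P? x →-dec Q? x)
    ×-dec
    ∀? (λ x≈y q⇒p → P-resp x≈y ∘ q⇒p ∘ Q-resp (sym x≈y))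
       (λ x → Q? x →-dec P? x)

  -- A class is represented by any of its members.
  quotient : {_∼_ : Rel Carrier 0ℓ} →
             IsDecEquivalence _∼_ → _≈_ ⇒ _∼_ → FiniteSet
  quotient isDecEquivalence ≈⇒∼ = record
    { decSetoid  = record { isDecEquivalence = isDecEquivalence }
    ; elements   = elements
    ; enumerates = λ x → Any.map ≈⇒∼ (enumerates x)
    }

record Graph (V : FiniteSet) : Set₁ where
  open FiniteSet V

  infix 4 _—_ _—?_

  field
    _—_      : Rel Carrier 0ℓ
    —-sym    : Symmetric _—_
    —-irrefl : Irreflexive _≈_ _—_
    —-respʳ  : _—_ Respectsʳ _≈_
    _—?_     : Decidable _—_

module _ {V : FiniteSet} (G : Graph V) where
  open FiniteSet V
  open Graph G

  N : Carrier → Pred Carrier 0ℓ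
  N v w = v — w

  ⟅_,_⟆ : Carrier → Carrier → Pred Carrier 0ℓ
  ⟅ u , v ⟆ w = w ≈ u ⊎ w ≈ v

  infix 4 _∼_ _∼′_

  _∼_ : Rel Carrier 0ℓ
  u ∼ v = N u ≐ N v

  _∼′_ : Rel Carrier 0ℓ
  u ∼′ v = N u ∖ ⟅ u , v ⟆ ≐ N v ∖ ⟅ u , v ⟆

  private
    —-respˡ : ∀ {u v w} → u ≈ v → u — w → v — w
    —-respˡ u≈v = —-sym ∘ —-respʳ u≈v ∘ —-sym

    ∖? : ∀ {P : Pred Carrier 0ℓ} → U.Decidable P →
         ∀ u v → U.Decidable (P ∖ ⟅ u , v ⟆)
    ∖? P? u v w = P? w ×-dec ¬? ((w ≟ u) ⊎-dec (w ≟ v))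

    ∖-resp : ∀ {P : Pred Carrier 0ℓ} → P Respects _≈_ →
             ∀ {u v} → (P ∖ ⟅ u , v ⟆) Respects _≈_
    ∖-resp resp x≈y (px , x∉) = resp x≈y px , λ where
      (inj₁ y≈u) → x∉ (inj₁ (trans x≈y y≈u))
      (inj₂ y≈v) → x∉ (inj₂ (trans x≈y y≈v))

    ∖-swap : ∀ {P : Pred Carrier 0ℓ} {u v} → P ∖ ⟅ u , v ⟆ U.⊆ P ∖ ⟅ v , u ⟆
    ∖-swap (px , x∉) = px , x∉ ∘ swap

    ∼′-sym : Symmetric _∼′_
    ∼′-sym {u} {v} (p , q) =
      (λ x∈ → ∖-swap {N u} (q (∖-swap {N v} x∈))) ,
      (λ x∈ → ∖-swap {N v} (p (∖-swap {N u} x∈)))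

    ∼′-step : ∀ {u v x} → u ∼′ v → u — x → ¬ x ≈ u → ¬ x ≈ v → v — x
    ∼′-step (p , _) ux x≉u x≉v =
      proj₁ (p (ux , λ { (inj₁ e) → x≉u e ; (inj₂ e) → x≉v e }))

    ∼′-trans-⊆ : ∀ {u v w} → u ∼′ v → v ∼′ w →
                 N u ∖ ⟅ u , w ⟆ U.⊆ N w ∖ ⟅ u , w ⟆
    ∼′-trans-⊆ {u} {v} {w} u∼v v∼w {x} (ux , x∉) = wx , x∉
      where
      wx : w — x
      wx with x ≟ v | u ≟ w
      ... | no x≉v  | _       = ∼′-step v∼w
                                  (∼′-step u∼v ux (x∉ ∘ inj₁) x≉v)
                                  x≉v (x∉ ∘ inj₂)
      ... | yes _   | yes u≈w = —-respˡ u≈w ux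
      ... | yes x≈v | no u≉w  = —-respʳ (sym x≈v) (—-sym vw)
        where
        uv : u — v
        uv = —-respʳ x≈v ux

        wu : w — u
        wu = ∼′-step v∼w (—-sym uv) (λ e → —-irrefl e uv) u≉w

        vw : v — w
        vw = ∼′-step u∼v (—-sym wu) (u≉w ∘ sym)
               (λ w≈v → x∉ (inj₂ (trans x≈v (sym w≈v))))

  ∼-isDecEquivalence : IsDecEquivalence _∼_
  ∼-isDecEquivalence = record
    { isEquivalence = record { refl = ≐-refl ; sym = ≐-sym ; trans = ≐-trans }
    ; _≟_ = λ u v → ≐? —-respʳ —-respʳ (u —?_) (v —?_)
    }

  ≈⇒∼ : _≈_ ⇒ _∼_
  ≈⇒∼ u≈v = —-respˡ u≈v , —-respˡ (sym u≈v)

  ∼′-isDecEquivalence : IsDecEquivalence _∼′_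
  ∼′-isDecEquivalence = record
    { isEquivalence = record
      { refl  = ≐-refl
      ; sym   = ∼′-sym
      ; trans = λ {u} {_} {w} u∼v v∼w →
          ∼′-trans-⊆ u∼v v∼w ,
          (λ x∈ → ∖-swap {N u}
                    (∼′-trans-⊆ (∼′-sym v∼w) (∼′-sym u∼v) (∖-swap {N w} x∈)))
      }
    ; _≟_ = λ u v → ≐? (∖-resp {N u} —-respʳ) (∖-resp {N v} —-respʳ)
                       (∖? (u —?_) u v) (∖? (v —?_) u v)
    }

  ≈⇒∼′ : _≈_ ⇒ _∼′_
  ≈⇒∼′ u≈v = (λ (ux , x∉) → —-respˡ u≈v ux , x∉)
           , (λ (vx , x∉) → —-respˡ (sym u≈v) vx , x∉)

  ClassesAdjacent : Rel Carrier 0ℓ → Rel Carrier 0ℓ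
  ClassesAdjacent _≋_ x y = ∃₂ λ u v → u ≋ x × v ≋ y × u — v

  private
    module ClassGraph {_≋_ : Rel Carrier 0ℓ} (≋-isDec : IsDecEquivalence _≋_)
                      (≈⇒≋ : _≈_ ⇒ _≋_) where
      open IsDecEquivalence ≋-isDec
        renaming (sym to ≋-sym; trans to ≋-trans; _≟_ to _≋?_) using ()

      adj-sym : Symmetric (ClassesAdjacent _≋_)
      adj-sym (u , v , ux , vy , uv) = v , u , vy , ux , —-sym uv

      adj-respʳ : ClassesAdjacent _≋_ Respectsʳ _≋_
      adj-respʳ y≋z (u , v , ux , vy , uv) = u , v , ux , ≋-trans vy y≋z , uv

      adj? : Decidable (ClassesAdjacent _≋_)
      adj? x y = ∃?
        (λ u≈u′ (v , ux , vy , uv) →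
           v , ≋-trans (≈⇒≋ (sym u≈u′)) ux , vy , —-respˡ u≈u′ uv)
        (λ u → ∃?
          (λ v≈v′ (ux , vy , uv) →
             ux , ≋-trans (≈⇒≋ (sym v≈v′)) vy , —-respʳ v≈v′ uv)
          (λ v → (u ≋? x) ×-dec ((v ≋? y) ×-dec (u —? v))))

  Classes : FiniteSet
  Classes = quotient ∼-isDecEquivalence ≈⇒∼

  reducedGraph : Graph Classes
  reducedGraph = record
    { _—_      = ClassesAdjacent _∼_
    ; —-sym    = adj-sym
    ; —-irrefl = λ x∼y (u , v , u∼x , v∼y , uv) →
        let u∼v = ≐-trans u∼x (≐-trans x∼y (≐-sym v∼y))
        in —-irrefl refl (proj₁ u∼v uv)
    ; —-respʳ  = adj-respʳ
    ; _—?_     = adj?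
    }
    where open ClassGraph ∼-isDecEquivalence ≈⇒∼

  Classes′ : FiniteSet
  Classes′ = quotient ∼′-isDecEquivalence ≈⇒∼′

  reducedGraph′ : Graph Classes′
  reducedGraph′ = record
    { _—_      = λ x y → ¬ x ∼′ y × ClassesAdjacent _∼′_ x y
    ; —-sym    = λ (x≁y , a) → x≁y ∘ ∼′-sym , adj-sym a
    ; —-irrefl = λ x∼y (x≁y , _) → x≁y x∼y
    ; —-respʳ  = λ y∼z (x≁y , a) →
        (λ x∼z → x≁y (∼′-trans x∼z (∼′-sym y∼z))) , adj-respʳ y∼z a
    ; _—?_     = λ x y → ¬? (x ∼′? y) ×-dec adj? x y
    }
    where
    open ClassGraph ∼′-isDecEquivalence ≈⇒∼′
    open IsDecEquivalence ∼′-isDecEquivalence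
      renaming (trans to ∼′-trans; _≟_ to _∼′?_) using ()

-- Two-sided Dedekind cuts.
record ℝ : Set₁ where
  field
    L U         : Pred ℚ 0ℓ
    L-inhabited : ∃ L
    U-inhabited : ∃ U
    L-rounded   : ∀ q → L q ⇔ (∃[ r ] q ℚ.< r × L r)
    U-rounded   : ∀ q → U q ⇔ (∃[ r ] r ℚ.< q × U r)
    disjoint    : ∀ q → ¬ (L q × U q)
    located     : ∀ {q r} → q ℚ.< r → L q ⊎ U r

infix 4 _<_ _≤_

_<_ : ℝ → ℝ → Set
x < y = ∃[ q ] ℝ.U x q × ℝ.L y q

_≤_ : ℝ → ℝ → Set
x ≤ y = ¬ y < x

record ClosedInterval : Set₁ where
  field
    lower upper : ℝ
    lower≤upper : lower ≤ upper

infix 4 _∈_ _≃_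

_∈_ : ℝ → ClosedInterval → Set
x ∈ I = ClosedInterval.lower I ≤ x × x ≤ ClosedInterval.upper I

_≃_ : ClosedInterval → ClosedInterval → Set₁
I ≃ J = ∀ x → x ∈ I ⇔ x ∈ J

Meets : ClosedInterval → ClosedInterval → Set₁
Meets I J = ∃[ x ] x ∈ I × x ∈ J

module _ {V : FiniteSet} where
  open FiniteSet V using (Carrier; _≈_; _≉_)

  IsIntervalGraph : Graph V → Set₁
  IsIntervalGraph H =
    Σ[ I ∈ (Carrier → ClosedInterval) ]
           (∀ {u v} → u ≈ v → I u ≃ I v)
         × (∀ {u v} → u ≉ v → u — v ⇔ Meets (I u) (I v))
    where open Graph H using (_—_)

  -- Only pairs of distinct vertices count, so d = 0 means H is complete.
  IsIntersectionOfIntervalGraphs : Graph V → ℕ → Set₁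
  IsIntersectionOfIntervalGraphs H d =
    Σ[ I ∈ (Fin d → Graph V) ]
           (∀ j → IsIntervalGraph (I j))
         × (∀ {u v} → u ≉ v → Graph._—_ H u v ⇔ (∀ j → Graph._—_ (I j) u v))

  HasBoxicity : Graph V → ℕ → Set₁
  HasBoxicity H d = IsIntersectionOfIntervalGraphs H d
                  × (∀ {e} → IsIntersectionOfIntervalGraphs H e → d ℕ.≤ e)

{-# OPTIONS --safe #-}

-- A class of ∼′ is either independent, hence a single vertex of G_E, or a
-- clique, hence a set of true twins of G_E. So G_E arises from G_E′ by
-- replacing vertices by cliques of twins, and G_E′ is an induced subgraph of
-- G_E. Repeating intervals on twins and restricting to a subgraph both
-- preserve interval representations, so the same d are attained by both graphs.
--
-- That a least d exists constructively needs "box H ≤ d" to be decidable.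
-- Interval representations correspond to interval orders (Fishburn), and
-- realizers of H by d interval orders form a finite search space. Real intervals
-- yield a realizer only up to double negation, which decidability removes.
module Submission where

open import Defs
open import Data.Fin.Base using (Fin; zero; suc; combine; remQuot)
open import Data.Fin.Properties using (_≟_; all?; any?; ≡-decSetoid; sequence;
  combine-injective; remQuot-combine)
open import Data.Fin.Subset as Subset using (Subset; ∣_∣)
open import Data.Fin.Subset.Properties using (_∈?_; anySubset?; p⊆q⇒∣p∣≤∣q∣; p⊂q⇒∣p∣<∣q∣)
open import Data.Integer.Base as ℤ using (+_; +≤+)
open import Data.Integer.Properties using (drop‿+≤+)
import Data.Integer.Properties as ℤₚ
open import Data.List.Base using (List; _∷_; length; lookup; allFin)
open import Data.List.Membership.Propositional.Properties using (∈-allFin)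
import Data.List.Membership.Setoid as Membership
import Data.List.Relation.Unary.Any as Any
open import Data.Nat.Base as ℕ using (ℕ; zero; suc; z≤n; s≤s)
import Data.Nat.Properties as ℕₚ
open import Data.Product.Base using (∃; ∃-syntax; Σ-syntax; _×_; _,_; proj₁; proj₂; map₂)
open import Data.Rational.Base as ℚ using (ℚ; 1ℚ)
open import Data.Rational.Literals using (fromℤ)
import Data.Rational.Properties as ℚₚ
open import Data.Sum.Base as Sum using (_⊎_; inj₁; inj₂; [_,_]′)
open import Data.Vec.Base using (tabulate)
open import Data.Vec.Properties using (lookup∘tabulate; []=⇒lookup; lookup⇒[]=)
open import Effect.Monad using (RawMonad)
open import Function.Base using (_∘_; id; case_of_)
open import Function.Bundles using (_⇔_; mk⇔; Equivalence)
open import Level using (0ℓ)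
open import Relation.Binary.Core using (Rel)
open import Relation.Binary.Definitions using (Decidable; tri<; tri≈; tri>)
open import Relation.Binary.PropositionalEquality
  using (_≡_; _≢_; refl; sym; trans; cong; subst; subst₂)
open import Relation.Nullary.Decidable as Dec
  using (Dec; yes; no; does; ¬?; _×-dec_; _⊎-dec_; _→-dec_; decidable-stable;
         dec-true; proof; ¬¬-excluded-middle)
open import Relation.Nullary.Negation using (¬_; contradiction; ¬¬-Monad; ¬¬-map)
open import Relation.Nullary.Reflects using (Reflects; invert)
import Relation.Unary as U
open import Relation.Unary using (Pred)

open Equivalence using (to; from)

-- Least witnesses and decidable subsets

least : ∀ {p} {P : ℕ → Set p} → U.Decidable P → ∀ n → P n →
        ∃[ d ] P d × (∀ {e} → P e → d ℕ.≤ e)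
least P? n pn with P? 0
least P? n       pn | yes p0 = 0 , p0 , λ _ → z≤n
least P? zero    pn | no ¬p0 = contradiction pn ¬p0
least {P = P} P? (suc n) pn | no ¬p0 with least (P? ∘ suc) n pn
... | d , pd , min = suc d , pd , λ {e} → min′ e
  where
  min′ : ∀ e → P e → suc d ℕ.≤ e
  min′ zero    p0 = contradiction p0 ¬p0
  min′ (suc _) pe = s≤s (min pe)

decSubset : ∀ {n} {P : Pred (Fin n) 0ℓ} → U.Decidable P → Subset n
decSubset P? = tabulate (does ∘ P?)

∈-decSubset : ∀ {n} {P : Pred (Fin n) 0ℓ} (P? : U.Decidable P) {i} →
              i Subset.∈ decSubset P? ⇔ P i
∈-decSubset P? {i} = mk⇔
  (λ i∈ → invert (subst (Reflects _) (trans (sym (lookup∘tabulate _ i)) ([]=⇒lookup i∈))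
                        (proof (P? i))))
  (λ p → lookup⇒[]= i _ (trans (lookup∘tabulate _ i) (dec-true (P? i) p)))

-- Real numbers

module _ (x : ℝ) where
  open ℝ x

  L⇒<U : ∀ {p q} → L p → U q → p ℚ.< q
  L⇒<U {p} {q} Lp Uq with ℚₚ.<-cmp p q
  ... | tri< p<q _ _ = p<q
  ... | tri≈ _ p≡q _ = contradiction (subst L p≡q Lp , Uq) (disjoint q)
  ... | tri> _ _ q<p = contradiction (from (L-rounded q) (p , q<p , Lp) , Uq) (disjoint q)

≤-refl : ∀ {x} → x ≤ x
≤-refl {x} (q , Uq , Lq) = ℝ.disjoint x q (Lq , Uq)

<⇒≤ : ∀ {x y} → x < y → x ≤ y
<⇒≤ {x} {y} (p , Up , Lp) (q , Uq , Lq) =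
  ℚₚ.<-asym (L⇒<U y Lp Uq) (L⇒<U x Lq Up)

-- Roundedness opens a gap `p < q` below `y`. Locating `z` in this gap either puts `p` below `z` or
-- contradicts `y ≤ z`.
<-≤-trans : ∀ {x y z} → x < y → y ≤ z → x < z
<-≤-trans {y = y} {z} (p , Up , Lp) y≤z with to (ℝ.L-rounded y p) Lp
... | q , p<q , Lq with ℝ.located z p<q
... | inj₁ Lzp = p , Up , Lzp
... | inj₂ Uzq = contradiction (q , Uzq , Lq) y≤z

≤-trans : ∀ {x y z} → x ≤ y → y ≤ z → x ≤ z
≤-trans {x} {y} {z} x≤y y≤z z<x = y≤z (<-≤-trans {z} {x} {y} z<x x≤y)

fromℚ : ℚ → ℝ
fromℚ q = record
  { L           = ℚ._< q
  ; U           = q ℚ.<_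
  ; L-inhabited = q ℚ.- 1ℚ , subst (q ℚ.- 1ℚ ℚ.<_) (ℚₚ.+-identityʳ q)
                               (ℚₚ.+-monoʳ-< q (ℚₚ.negative⁻¹ (ℚ.- 1ℚ)))
  ; U-inhabited = q ℚ.+ 1ℚ , subst (ℚ._< q ℚ.+ 1ℚ) (ℚₚ.+-identityʳ q)
                               (ℚₚ.+-monoʳ-< q (ℚₚ.positive⁻¹ 1ℚ))
  ; L-rounded   = λ p → mk⇔ ℚₚ.<-dense (λ (r , p<r , r<q) → ℚₚ.<-trans p<r r<q)
  ; U-rounded   = λ p → mk⇔
      (λ q<p → let r , q<r , r<p = ℚₚ.<-dense q<p in r , r<p , q<r)
      (λ (r , r<p , q<r) → ℚₚ.<-trans q<r r<p)
  ; disjoint    = λ p (p<q , q<p) → ℚₚ.<-asym p<q q<p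
  ; located     = λ {p} {r} p<r → case p ℚₚ.<? q of λ where
      (yes p<q) → inj₁ p<q
      (no  p≮q) → inj₂ (ℚₚ.≤-<-trans (ℚₚ.≮⇒≥ p≮q) p<r)
  }

fromℕ : ℕ → ℝ
fromℕ n = fromℚ (fromℤ (+ n))

fromℕ-≤ : ∀ {m n} → fromℕ m ≤ fromℕ n ⇔ m ℕ.≤ n
fromℕ-≤ {m} {n} = mk⇔
  (λ m≤n → drop‿+≤+ (subst₂ ℤ._≤_ (ℤₚ.*-identityʳ (+ m)) (ℤₚ.*-identityʳ (+ n))
             (ℚₚ.drop-*≤* (ℚₚ.≮⇒≥ λ n<m → m≤n (ℚₚ.<-dense n<m)))))
  (λ m≤n (q , n<q , q<m) → ℚₚ.<-irrefl refl (ℚₚ.<-≤-trans (ℚₚ.<-trans n<q q<m)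
    (ℚ.*≤* (subst₂ ℤ._≤_ (sym (ℤₚ.*-identityʳ (+ m))) (sym (ℤₚ.*-identityʳ (+ n)))
             (+≤+ m≤n)))))

-- Intervals

module _ (I : ClosedInterval) where
  open ClosedInterval I

  lower∈ : lower ∈ I
  lower∈ = ≤-refl {lower} , lower≤upper

≃⇒Meets : ∀ {I J} → I ≃ J → Meets I J
≃⇒Meets {I} I≃J = lower , lower∈ I , to (I≃J lower) (lower∈ I)
  where open ClosedInterval I using (lower)

module _ (I J : ClosedInterval) where
  private
    module I = ClosedInterval I
    module J = ClosedInterval J

  Meets⇒lower≤upper : Meets I J → I.lower ≤ J.upper × J.lower ≤ I.upper
  Meets⇒lower≤upper (x , (lI≤x , x≤uI) , (lJ≤x , x≤uJ)) =
    ≤-trans {I.lower} {x} {J.upper} lI≤x x≤uJ , ≤-trans {J.lower} {x} {I.upper} lJ≤x x≤uI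

  -- The larger of the two lower ends lies in both intervals. The order of cuts is not decidable, so
  -- the case distinction stays under a double negation.
  lower≤upper⇒¬¬Meets : I.lower ≤ J.upper → J.lower ≤ I.upper → ¬ ¬ Meets I J
  lower≤upper⇒¬¬Meets lI≤uJ lJ≤uI = ¬¬-map
    (λ where
      (yes lI<lJ) → J.lower , (<⇒≤ {I.lower} {J.lower} lI<lJ , lJ≤uI) , lower∈ J
      (no  lI≮lJ) → I.lower , lower∈ I , (lI≮lJ , lI≤uJ))
    ¬¬-excluded-middle

natInterval : ∀ {m n} → m ℕ.≤ n → ClosedInterval
natInterval {m} {n} m≤n = record
  { lower = fromℕ m ; upper = fromℕ n ; lower≤upper = from fromℕ-≤ m≤n }

natInterval-Meets : ∀ {k l m n} (k≤l : k ℕ.≤ l) (m≤n : m ℕ.≤ n) →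
  Meets (natInterval k≤l) (natInterval m≤n) ⇔ (k ℕ.≤ n × m ℕ.≤ l)
natInterval-Meets {k} {l} {m} {n} k≤l m≤n = mk⇔
  (λ meets → let k≤n , m≤l = Meets⇒lower≤upper (natInterval k≤l) (natInterval m≤n) meets
             in to fromℕ-≤ k≤n , to fromℕ-≤ m≤l)
  -- For natural end points the larger lower end is computable, so no double negation arises.
  (λ (k≤n , m≤l) → fromℕ (k ℕ.⊔ m) ,
    (from fromℕ-≤ (ℕₚ.m≤m⊔n k m) , from fromℕ-≤ (ℕₚ.⊔-lub k≤l m≤l)) ,
    (from fromℕ-≤ (ℕₚ.m≤n⊔m k m) , from fromℕ-≤ (ℕₚ.⊔-lub k≤n m≤n)))

-- Interval orders

-- Fishburn's axioms. Taking `c` equal to `b` in `2+2-free` gives transitivity, as `irrefl` excludes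
-- `b ≺ b`.
record IsIntervalOrder {A : Set} (_≺_ : Rel A 0ℓ) : Set where
  field
    irrefl   : ∀ {a} → ¬ a ≺ a
    2+2-free : ∀ {a b c d} → a ≺ b → c ≺ d → a ≺ d ⊎ c ≺ b

-- The predecessor sets form a chain. The interval of v runs from the size of
-- its predecessor set to that of the largest predecessor set of an element not
-- above v.
module Canonical {n} {_≺_ : Rel (Fin n) 0ℓ} (≺-isIntervalOrder : IsIntervalOrder _≺_)
                 (_≺?_ : Decidable _≺_) where
  open IsIntervalOrder ≺-isIntervalOrder

  lower? : ∀ v → U.Decidable (_≺ v)
  lower? v x = x ≺? v

  -- As the predecessor sets form a chain, this union of some of them is the largest one, and no
  -- maximiser has to be chosen.
  Upper : Fin n → Pred (Fin n) 0ℓ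
  Upper v x = ∃[ w ] ¬ v ≺ w × x ≺ w

  upper? : ∀ v → U.Decidable (Upper v)
  upper? v x = any? λ w → ¬? (v ≺? w) ×-dec (x ≺? w)

  lower upper : Fin n → ℕ
  lower v = ∣ decSubset (lower? v) ∣
  upper v = ∣ decSubset (upper? v) ∣

  ⊀⇒lower≤upper : ∀ {u v} → ¬ u ≺ v → lower v ℕ.≤ upper u
  ⊀⇒lower≤upper {u} {v} u⊀v = p⊆q⇒∣p∣≤∣q∣ λ x∈ →
    from (∈-decSubset (upper? u)) (v , u⊀v , to (∈-decSubset (lower? v)) x∈)

  -- If `x ≺ w` and `¬ u ≺ w`, then `2+2-free` against `u ≺ v` leaves only `x ≺ v`, which gives an
  -- inclusion of the counted sets. It is strict because of `u` itself.
  ≺⇒upper<lower : ∀ {u v} → u ≺ v → upper u ℕ.< lower v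
  ≺⇒upper<lower {u} {v} u≺v = p⊂q⇒∣p∣<∣q∣
    ( (λ x∈ → let w , u⊀w , x≺w = to (∈-decSubset (upper? u)) x∈ in
        from (∈-decSubset (lower? v))
          ([ id , (λ u≺w → contradiction u≺w u⊀w) ]′ (2+2-free x≺w u≺v)))
    , u , from (∈-decSubset (lower? v)) u≺v
    , λ u∈ → let w , u⊀w , u≺w = to (∈-decSubset (upper? u)) u∈ in u⊀w u≺w )

  interval : Fin n → ClosedInterval
  interval v = natInterval (⊀⇒lower≤upper {v} irrefl)

  interval-Meets : ∀ {u v} → (¬ u ≺ v × ¬ v ≺ u) ⇔ Meets (interval u) (interval v)
  interval-Meets {u} {v} = mk⇔
    (λ (u⊀v , v⊀u) → from meets⇔ (⊀⇒lower≤upper v⊀u , ⊀⇒lower≤upper u⊀v))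
    (λ m → let lu≤uv , lv≤uu = to meets⇔ m in
      (λ u≺v → ℕₚ.<⇒≱ (≺⇒upper<lower u≺v) lv≤uu) ,
      (λ v≺u → ℕₚ.<⇒≱ (≺⇒upper<lower v≺u) lu≤uv))
    where
    meets⇔ = natInterval-Meets (⊀⇒lower≤upper {u} irrefl) (⊀⇒lower≤upper {v} irrefl)

-- Realizers

finiteSet : ℕ → FiniteSet
finiteSet n = record
  { decSetoid = ≡-decSetoid n ; elements = allFin n ; enumerates = ∈-allFin }

module _ {n} (H : Graph (finiteSet n)) where
  open Graph H

  -- Interval graphs are the incomparability graphs of interval orders. Orders stand in for real
  -- intervals because the decidable ones on `Fin n` can be searched exhaustively.
  IsRealizer : ∀ {d} → (Fin d → Rel (Fin n) 0ℓ) → Set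
  IsRealizer _≺[_]_ = (∀ k → IsIntervalOrder (_≺[_]_ k))
    × (∀ u v → u ≢ v → u — v ⇔ (∀ k → ¬ _≺[_]_ k u v × ¬ _≺[_]_ k v u))

  IsRealizer-resp-⇔ : ∀ {d} {R S : Fin d → Rel (Fin n) 0ℓ} →
    (∀ k {u v} → R k u v ⇔ S k u v) → IsRealizer R → IsRealizer S
  IsRealizer-resp-⇔ R⇔S (orders , realizes) =
    (λ k → let open IsIntervalOrder (orders k) in record
      { irrefl   = λ a≺a → irrefl (from (R⇔S k) a≺a)
      ; 2+2-free = λ a≺b c≺d → Sum.map (to (R⇔S k)) (to (R⇔S k))
                     (2+2-free (from (R⇔S k) a≺b) (from (R⇔S k) c≺d))
      }) ,
    (λ u v u≢v → mk⇔
      (λ uv k → let ¬uv , ¬vu = to (realizes u v u≢v) uv k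
                in ¬uv ∘ from (R⇔S k) , ¬vu ∘ from (R⇔S k))
      (λ incomp → from (realizes u v u≢v) λ k →
        let ¬uv , ¬vu = incomp k in ¬uv ∘ to (R⇔S k) , ¬vu ∘ to (R⇔S k)))

  module _ {d} {R : Fin d → Rel (Fin n) 0ℓ} (R? : ∀ k → Decidable (R k)) where

    isRealizer? : Dec (IsRealizer R)
    isRealizer? =
      all? (λ k → Dec.map′
        (λ (irr , free) → record { irrefl   = λ {a} → irr a
                                 ; 2+2-free = λ {a} {b} {c} {d} → free a b c d })
        (λ o → let open IsIntervalOrder o in
               (λ _ → irrefl) , (λ _ _ _ _ → 2+2-free))
        (all? (λ a → ¬? (R? k a a)) ×-dec
         all? (λ a → all? λ b → all? λ c → all? λ d →
           R? k a b →-dec (R? k c d →-dec (R? k a d ⊎-dec R? k c b)))))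
      ×-dec
      all? (λ u → all? λ v → ¬? (u ≟ v) →-dec
        let incomp? = all? λ k → ¬? (R? k u v) ×-dec ¬? (R? k v u) in
        Dec.map′ (λ (f , g) → mk⇔ f g) (λ e → to e , from e)
          ((u —? v →-dec incomp?) ×-dec (incomp? →-dec u —? v)))

  realizer⇒intersection : ∀ {d} {R : Fin d → Rel (Fin n) 0ℓ} →
    (∀ k → Decidable (R k)) → IsRealizer R → IsIntersectionOfIntervalGraphs H d
  realizer⇒intersection {d} {R} R? (orders , realizes) =
    incomparability , isIntervalGraph , λ u≢v → mk⇔
      (λ uv k → u≢v , to (realizes _ _ u≢v) uv k)
      (λ uv → from (realizes _ _ u≢v) (proj₂ ∘ uv))
    where
    incomparability : Fin d → Graph (finiteSet n)
    incomparability k = record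
      { _—_      = λ u v → u ≢ v × ¬ R k u v × ¬ R k v u
      ; —-sym    = λ (u≢v , ¬uv , ¬vu) → u≢v ∘ sym , ¬vu , ¬uv
      ; —-irrefl = λ u≡v (u≢v , _) → u≢v u≡v
      ; —-respʳ  = λ { refl uv → uv }
      ; _—?_     = λ u v → ¬? (u ≟ v) ×-dec ¬? (R? k u v) ×-dec ¬? (R? k v u)
      }

    isIntervalGraph : ∀ k → IsIntervalGraph (incomparability k)
    isIntervalGraph k = interval
      , (λ { refl x → mk⇔ id id })
      , λ u≢v → mk⇔ (to interval-Meets ∘ proj₂) (λ m → u≢v , from interval-Meets m)
      where open Canonical (orders k) (R? k)

  -- One vertex precedes another when its interval ends before the other begins. These comparisons
  -- of reals are not decidable, but there are finitely many, so under a double negation all of them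
  -- are decided at once.
  intersection⇒¬¬realizer : ∀ {d} → IsIntersectionOfIntervalGraphs H d →
    ¬ ¬ (Σ[ R ∈ (Fin d → Rel (Fin n) 0ℓ) ] (∀ k → Decidable (R k)) × IsRealizer R)
  intersection⇒¬¬realizer {d} (J , isIntervalGraph , intersection) =
    ¬¬-map (λ R? → R , R? , isRealizer R?)
      (choose λ k → choose λ u → choose λ v → ¬¬-excluded-middle)
    where
    choose : ∀ {m} {P : Pred (Fin m) 0ℓ} → (∀ i → ¬ ¬ P i) → ¬ ¬ (∀ i → P i)
    choose = sequence (RawMonad.rawApplicative ¬¬-Monad)

    I : Fin d → Fin n → ClosedInterval
    I k = proj₁ (isIntervalGraph k)

    module I k u = ClosedInterval (I k u)

    R : Fin d → Rel (Fin n) 0ℓ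
    R k u v = I.upper k u < I.lower k v

    Meets⇔ : ∀ k {u v} → u ≢ v → Graph._—_ (J k) u v ⇔ Meets (I k u) (I k v)
    Meets⇔ k = proj₂ (proj₂ (isIntervalGraph k))

    2+2-free : (∀ k → Decidable (R k)) →
               ∀ k {a b c d} → R k a b → R k c d → R k a d ⊎ R k c b
    2+2-free R? k {a} {b} {c} {d} a≺b c≺d with R? k a d | R? k c b
    ... | yes a≺d | _       = inj₁ a≺d
    ... | no _    | yes c≺b = inj₂ c≺b
    -- Otherwise the ends form a cycle: `upper a < lower b ≤ upper c < lower d ≤ upper a`.
    ... | no a⊀d  | no c⊀b  = contradiction
      (<-≤-trans {I.upper k a} {I.lower k b} {I.upper k c} a≺b c⊀b)
      (<⇒≤ {I.upper k c} {I.upper k a}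
        (<-≤-trans {I.upper k c} {I.lower k d} {I.upper k a} c≺d a⊀d))

    isRealizer : (∀ k → Decidable (R k)) → IsRealizer R
    isRealizer R? =
      (λ k → record
        -- `x ≤ y` unfolds to `¬ y < x`, so here and below failures of `R` are themselves
        -- inequalities between ends.
        { irrefl   = λ {a} → I.lower≤upper k a
        ; 2+2-free = 2+2-free R? k
        }) ,
      (λ u v u≢v → mk⇔
        (λ uv k → let lu≤uv , lv≤uu = Meets⇒lower≤upper (I k u) (I k v)
                                        (to (Meets⇔ k u≢v) (to (intersection u≢v) uv k))
                  in lv≤uu , lu≤uv)
        -- Adjacency in `J k` is decidable, which removes the double negation from the meeting of
        -- the intervals.
        (λ incomp → from (intersection u≢v) λ k → decidable-stable (Graph._—?_ (J k) u v)
          (¬¬-map (from (Meets⇔ k u≢v))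
            (let lv≤uu , lu≤uv = incomp k
             in lower≤upper⇒¬¬Meets (I k u) (I k v) lu≤uv lv≤uu))))

  -- A subset of `Fin (d ℕ.* (n ℕ.* n))` codes `d` binary relations, so the search is finite. If it
  -- fails, a contradiction is to be derived, and for this a doubly negated realizer suffices.
  intersection? : U.Decidable (IsIntersectionOfIntervalGraphs H)
  intersection? d = case anySubset? (λ s → isRealizer? (relation? s)) of λ where
      (yes (s , realizes)) → yes (realizer⇒intersection (relation? s) realizes)
      (no  ∄realizer)      → no λ intersection →
        intersection⇒¬¬realizer intersection λ (_ , R? , realizes) →
          ∄realizer (_ , IsRealizer-resp-⇔ (encode⇔ R?) realizes)
    where
    relation : Subset (d ℕ.* (n ℕ.* n)) → Fin d → Rel (Fin n) 0ℓ
    relation s k u v = combine k (combine u v) Subset.∈ s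

    relation? : ∀ s k → Decidable (relation s k)
    relation? s k u v = combine k (combine u v) ∈? s

    module _ {R : Fin d → Rel (Fin n) 0ℓ} (R? : ∀ k → Decidable (R k)) where
      decode : Fin (d ℕ.* (n ℕ.* n)) → Fin d × Fin n × Fin n
      decode = map₂ (remQuot n) ∘ remQuot (n ℕ.* n)

      decode-combine : ∀ k u v → decode (combine k (combine u v)) ≡ (k , u , v)
      decode-combine k u v = trans
        (cong (map₂ (remQuot n)) (remQuot-combine k (combine u v)))
        (cong (k ,_) (remQuot-combine u v))

      encode? : U.Decidable (λ i → let k , u , v = decode i in R k u v)
      encode? i = let k , u , v = decode i in R? k u v

      encode⇔ : ∀ k {u v} → R k u v ⇔ relation (decSubset encode?) k u v
      encode⇔ k {u} {v} = mk⇔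
        (λ r → from (∈-decSubset encode?) (subst R′ (sym (decode-combine k u v)) r))
        (λ r → subst R′ (decode-combine k u v) (to (∈-decSubset encode?) r))
        where
        R′ : Pred (Fin d × Fin n × Fin n) 0ℓ
        R′ (k , u , v) = R k u v

  -- For each non-edge uv one interval order, in which only u ≺ v.
  intersection-exists : ∃ (IsIntersectionOfIntervalGraphs H)
  intersection-exists = n ℕ.* n , realizer⇒intersection R? (isIntervalOrder , realizes)
    where
    R : Fin (n ℕ.* n) → Rel (Fin n) 0ℓ
    -- `k` runs over all ordered pairs. For an edge or a pair of equal vertices the relation is
    -- empty.
    R k u v = combine u v ≡ k × u ≢ v × ¬ u — v

    R? : ∀ k → Decidable (R k)
    R? k u v = (combine u v ≟ k) ×-dec ¬? (u ≟ v) ×-dec ¬? (u —? v)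

    isIntervalOrder : ∀ k → IsIntervalOrder (R k)
    isIntervalOrder k = record
      { irrefl   = λ (_ , a≢a , _) → a≢a refl
      -- `k` fixes the pair, so `b` and `d` coincide.
      ; 2+2-free = λ {a} {b} {c} {d} a≺b@(ab≡k , _) (cd≡k , _) →
          inj₁ (subst (R k a) (proj₂ (combine-injective a b c d (trans ab≡k (sym cd≡k)))) a≺b)
      }

    realizes : ∀ u v → u ≢ v → u — v ⇔ (∀ k → ¬ R k u v × ¬ R k v u)
    realizes u v u≢v = mk⇔
      (λ uv k → (λ (_ , _ , ¬uv) → ¬uv uv) , (λ (_ , _ , ¬vu) → ¬vu (—-sym uv)))
      (λ incomp → decidable-stable (u —? v) λ ¬uv →
        proj₁ (incomp (combine u v)) (refl , u≢v , ¬uv))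

-- Substituting cliques of twins

module _ {V W : FiniteSet} where
  private
    module V = FiniteSet V
    module W = FiniteSet W

  module _ (f : V.Carrier → W.Carrier) (f-cong : ∀ {u v} → u V.≈ v → f u W.≈ f v) where

    -- For injective `f` this is an induced subgraph of `J`, while a fibre with several points
    -- becomes a clique of twins. One construction thus covers both restriction and substitution.
    blowup : Graph W → Graph V
    blowup J = record
      { _—_      = λ u v → u V.≉ v × (f u W.≈ f v ⊎ f u — f v)
      ; —-sym    = λ (u≉v , uv) → u≉v ∘ V.sym , Sum.map W.sym —-sym uv
      ; —-irrefl = λ u≈v (u≉v , _) → u≉v u≈v
      ; —-respʳ  = λ v≈w (u≉v , uv) →
          (λ u≈w → u≉v (V.trans u≈w (V.sym v≈w))) ,
          Sum.map (λ fu≈fv → W.trans fu≈fv (f-cong v≈w)) (—-respʳ (f-cong v≈w)) uv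
      ; _—?_     = λ u v → ¬? (u V.≟ v) ×-dec ((f u W.≟ f v) ⊎-dec (f u —? f v))
      }
      where open Graph J

    -- The points of a fibre share one interval, which meets itself because it contains its lower
    -- end.
    blowup-isIntervalGraph : ∀ {J} → IsIntervalGraph J → IsIntervalGraph (blowup J)
    blowup-isIntervalGraph {J} (I , I-cong , meets) =
      I ∘ f , I-cong ∘ f-cong , λ {u} {v} u≉v → mk⇔
        (λ (_ , uv) → case f u W.≟ f v of λ where
          (yes fu≈fv) → ≃⇒Meets {I (f u)} {I (f v)} (I-cong fu≈fv)
          (no  fu≉fv) → to (meets fu≉fv) ([ (λ e → contradiction e fu≉fv) , id ]′ uv))
        (λ m → u≉v , (case f u W.≟ f v of λ where
          (yes fu≈fv) → inj₁ fu≈fv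
          (no  fu≉fv) → inj₂ (from (meets fu≉fv) m)))

    -- The source of all transfers below: between a graph and its copy on `Fin n`, and between the
    -- two quotients.
    intersection-blowup : (K : Graph V) (H : Graph W) →
      (∀ {u v} → u V.≉ v → Graph._—_ K u v ⇔ (f u W.≈ f v ⊎ Graph._—_ H (f u) (f v))) →
      ∀ {d} → IsIntersectionOfIntervalGraphs H d → IsIntersectionOfIntervalGraphs K d
    intersection-blowup K H K⇔H {d} (J , isIntervalGraph , intersection) =
      blowup ∘ J , (λ j → blowup-isIntervalGraph {J j} (isIntervalGraph j)) , λ {u} {v} u≉v →
      mk⇔
        (λ uv j → u≉v , (case to (K⇔H u≉v) uv of λ where
          (inj₁ fu≈fv) → inj₁ fu≈fv
          (inj₂ fufv)  → inj₂ (to (intersection λ e → Graph.—-irrefl H e fufv) fufv j)))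
        (λ uv → from (K⇔H u≉v) (case f u W.≟ f v of λ where
          (yes fu≈fv) → inj₁ fu≈fv
          (no  fu≉fv) → inj₂ (from (intersection fu≉fv) λ j →
            [ (λ e → contradiction e fu≉fv) , id ]′ (proj₂ (uv j)))))

-- Canonical representatives

module Index (V : FiniteSet) where
  open FiniteSet V renaming (_≟_ to _≈?_; refl to ≈-refl; sym to ≈-sym; trans to ≈-trans)
  open Membership setoid renaming (_∈_ to _∈ˡ_)

  -- The position is found by deciding equality and not read off from `u∈`, so that equal elements
  -- get the same index.
  firstIndex : ∀ {u} xs → u ∈ˡ xs → Fin (length xs)
  firstIndex {u} (x ∷ xs) u∈ with u ≈? x
  ... | yes _   = zero
  ... | no  u≉x = suc (firstIndex xs (Any.tail u≉x u∈))

  firstIndex-cong : ∀ {u v} xs (u∈ : u ∈ˡ xs) (v∈ : v ∈ˡ xs) → u ≈ v →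
                    firstIndex xs u∈ ≡ firstIndex xs v∈
  firstIndex-cong {u} {v} (x ∷ xs) u∈ v∈ u≈v with u ≈? x | v ≈? x
  ... | yes _   | yes _   = refl
  ... | yes u≈x | no  v≉x = contradiction (≈-trans (≈-sym u≈v) u≈x) v≉x
  ... | no  u≉x | yes v≈x = contradiction (≈-trans u≈v v≈x) u≉x
  ... | no  _   | no  _   = cong suc (firstIndex-cong xs _ _ u≈v)

  lookup-firstIndex : ∀ {u} xs (u∈ : u ∈ˡ xs) → lookup xs (firstIndex xs u∈) ≈ u
  lookup-firstIndex {u} (x ∷ xs) u∈ with u ≈? x
  ... | yes u≈x = ≈-sym u≈x
  ... | no  _   = lookup-firstIndex xs _

  index : Carrier → Fin (length elements)
  index u = firstIndex elements (enumerates u)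

  index-cong : ∀ {u v} → u ≈ v → index u ≡ index v
  index-cong = firstIndex-cong elements _ _

  element : Fin (length elements) → Carrier
  element = lookup elements

  element-index : ∀ u → element (index u) ≈ u
  element-index u = lookup-firstIndex elements (enumerates u)

module _ {V : FiniteSet} (H : Graph V) where
  open FiniteSet V renaming (refl to ≈-refl; sym to ≈-sym; trans to ≈-trans)
  open Graph H
  open Index V

  -- The enumeration may repeat an element: repetitions become twins.
  indexGraph : Graph (finiteSet (length elements))
  indexGraph = blowup {W = V} element (λ { refl → ≈-refl }) H

  intersection⇒indexGraph : ∀ {d} →
    IsIntersectionOfIntervalGraphs H d → IsIntersectionOfIntervalGraphs indexGraph d
  intersection⇒indexGraph =
    intersection-blowup element (λ { refl → ≈-refl }) indexGraph H
      (λ i≢j → mk⇔ proj₂ (i≢j ,_))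

  -- `element` undoes `index` up to `≈`, so `index` is injective and embeds `H` as an induced
  -- subgraph.
  indexGraph⇒intersection : ∀ {d} →
    IsIntersectionOfIntervalGraphs indexGraph d → IsIntersectionOfIntervalGraphs H d
  indexGraph⇒intersection = intersection-blowup index index-cong H indexGraph λ {u} {v} u≉v →
    let element-index-injective : element (index u) ≈ element (index v) → u ≈ v
        element-index-injective e =
          ≈-trans (≈-sym (element-index u)) (≈-trans e (element-index v))
        index-injective : index u ≡ index v → u ≈ v
        index-injective e =
          element-index-injective (subst (λ i → element (index u) ≈ element i) e ≈-refl)
    in mk⇔
      (λ uv → inj₂ (u≉v ∘ index-injective ,
        inj₂ (—-respʳ (≈-sym (element-index v))
               (—-sym (—-respʳ (≈-sym (element-index u)) (—-sym uv))))))
      (λ where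
        (inj₁ e)              → contradiction (index-injective e) u≉v
        (inj₂ (_ , inj₁ e))   → contradiction (element-index-injective e) u≉v
        (inj₂ (_ , inj₂ uv))  →
          —-respʳ (element-index v) (—-sym (—-respʳ (element-index u) (—-sym uv))))

  boxicity : ∃[ d ] HasBoxicity H d
  boxicity =
    let d , d-intersection = intersection-exists indexGraph in
    least (λ e → Dec.map′ indexGraph⇒intersection intersection⇒indexGraph
                   (intersection? indexGraph e))
          d (indexGraph⇒intersection d-intersection)

-- The two quotients

module _ {V : FiniteSet} (G : Graph V) where
  open FiniteSet V renaming (refl to ≈-refl; sym to ≈-sym; trans to ≈-trans)
  open Graph G
  private
    module E  = Graph (reducedGraph G)
    module E′ = Graph (reducedGraph′ G)
    module C  = FiniteSet (Classes G)
    module C′ = FiniteSet (Classes′ G)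

  ∼⇒∼′ : ∀ {u v} → u C.≈ v → u C′.≈ v
  ∼⇒∼′ (u⊆v , v⊆u) = (λ (ux , x∉) → u⊆v ux , x∉) , (λ (vx , x∉) → v⊆u vx , x∉)

  -- By irreflexivity a neighbour of `u` is never `u`, so avoiding `v` already places `x` outside
  -- the deleted pair.
  ∼′-step : ∀ {u v x} → u C′.≈ v → u — x → x ≉ v → v — x
  ∼′-step (u⊆v , _) ux x≉v =
    proj₁ (u⊆v (ux , [ (λ x≈u → —-irrefl (≈-sym x≈u) ux) , x≉v ]′))

  -- Without the edge, deleting `u` and `v` removes nothing from either neighbourhood.
  ∼′-nonadjacent⇒∼ : ∀ {u v} → u C′.≈ v → ¬ u — v → u C.≈ v
  ∼′-nonadjacent⇒∼ u∼′v ¬uv =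
    (λ ux → ∼′-step u∼′v ux λ x≈v → ¬uv (—-respʳ x≈v ux)) ,
    (λ vx → ∼′-step (C′.sym u∼′v) vx λ x≈u → ¬uv (—-sym (—-respʳ x≈u vx)))

  classesAdjacent : ∀ {u v} → u E.— v ⇔ u — v
  classesAdjacent {u} {v} = mk⇔
    (λ (_ , _ , u₁∼u , v₁∼v , u₁v₁) →
      —-sym (proj₁ v₁∼v (—-sym (proj₁ u₁∼u u₁v₁))))
    (λ uv → u , v , C.refl {u} , C.refl {v} , uv)

  classesAdjacent′ : ∀ {u v} → ¬ u C′.≈ v → u E′.— v ⇔ u — v
  classesAdjacent′ {u} {v} u≁′v = mk⇔
    (λ (_ , u₁ , v₁ , u₁∼u , v₁∼v , u₁v₁) →
      -- Representatives are exchanged one at a time. An exchange could fail only if `v₁ ≈ u` or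
      -- `u ≈ v`, and either would merge the two classes.
      let uv₁ = ∼′-step u₁∼u u₁v₁ λ v₁≈u →
                  u≁′v (C′.trans (≈⇒∼′ G (≈-sym v₁≈u)) v₁∼v)
      in —-sym (∼′-step v₁∼v (—-sym uv₁) λ u≈v → u≁′v (≈⇒∼′ G u≈v)))
    (λ uv → u≁′v , u , v , C′.refl {u} , C′.refl {v} , uv)

  -- Both quotients keep the carrier of `G`, so `id` sends each class of `∼` to the class of `∼′`
  -- around it. Distinct classes with the same image are adjacent by `∼′-nonadjacent⇒∼`, as the
  -- blowup demands.
  intersection′⇒intersection : ∀ {d} → IsIntersectionOfIntervalGraphs (reducedGraph′ G) d →
                               IsIntersectionOfIntervalGraphs (reducedGraph G) d
  intersection′⇒intersection =
    intersection-blowup id ∼⇒∼′ (reducedGraph G) (reducedGraph′ G) λ {u} {v} u≁v → mk⇔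
      (λ uv → case u C′.≟ v of λ where
        (yes u∼′v) → inj₁ u∼′v
        (no  u≁′v) → inj₂ (from (classesAdjacent′ u≁′v) (to classesAdjacent uv)))
      (λ where
        (inj₁ u∼′v) → from classesAdjacent
          (decidable-stable (u —? v) (u≁v ∘ ∼′-nonadjacent⇒∼ u∼′v))
        (inj₂ uv@(u≁′v , _)) → from classesAdjacent (to (classesAdjacent′ u≁′v) uv))

  -- Since `∼′` may be coarser than `∼`, `id` need not respect the equalities in this direction. One
  -- fixed vertex chosen from each class of `∼′` gives an embedding as an induced subgraph.
  intersection⇒intersection′ : ∀ {d} → IsIntersectionOfIntervalGraphs (reducedGraph G) d →
                               IsIntersectionOfIntervalGraphs (reducedGraph′ G) d
  intersection⇒intersection′ =
    intersection-blowup representative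
      (λ u∼′v → C.reflexive (cong element (index-cong u∼′v)))
      (reducedGraph′ G) (reducedGraph G) λ {u} {v} u≁′v →
      let ru≁′rv : ¬ representative u C′.≈ representative v
          ru≁′rv r = u≁′v
            (C′.trans (C′.sym (element-index u)) (C′.trans r (element-index v)))
      in mk⇔
        (λ uv → inj₂ (from classesAdjacent (to (classesAdjacent′ ru≁′rv)
          (E′.—-respʳ (C′.sym (element-index v))
            (E′.—-sym (E′.—-respʳ (C′.sym (element-index u)) (E′.—-sym uv)))))))
        (λ where
          (inj₁ r)  → contradiction (∼⇒∼′ r) ru≁′rv
          (inj₂ uv) → E′.—-respʳ (element-index v)
            (E′.—-sym (E′.—-respʳ (element-index u)
              (E′.—-sym (from (classesAdjacent′ ru≁′rv) (to classesAdjacent uv))))))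
    where
    open Index (Classes′ G)

    representative : Carrier → Carrier
    representative u = element (index u)

theorem35 : ∀ {V : FiniteSet} (G : Graph V) →
    ∃[ d ] HasBoxicity (reducedGraph G) d × HasBoxicity (reducedGraph′ G) d
theorem35 G =
  let d , intersection , minimal = boxicity (reducedGraph G) in
  d , (intersection , minimal)
    , (intersection⇒intersection′ G intersection , minimal ∘ intersection′⇒intersection G)
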